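{- Let $F$ be a field whose characteristic is not two, and let $P$ be a univariate polynomial with coefficients in $F$. Then $P$ is solvable in radicals relative to $F$ if and only if $P$ is solvable in Chebyshev radicals relative to $F$.
   Context: For an element $x$ of a ring and an integer $n\ge 0$, the $n$-th Chebyshev power $x^{\copyright n}$ is defined by $x^{\copyright 0}=2$, $x^{\copyright 1}=x$, $x^{\copyright n}=x\,x^{\copyright (n-1)}-x^{\copyright (n-2)}$. Let $P$ be a univariate polynomial with coefficients in a field $F_0$. $P$ is solvable in radicals relative to $F_0$ if there is a tower of fields $F_0\subseteq F_1\subseteq\cdots\subseteq F_n$ such that $P$ factors completely into linear factors over $F_n$ and, for each $0<i\le n$, $F_i=F_{i-1}(r_i)$ with $r_i^{m_i}\in F_{i-1}$ for some positive integer $m_i$. $P$ is solvable in Chebyshev radicals relative to $F_0$ if there is such a tower with $r_i^{m_i}\in F_{i-1}$ replaced by $r_i^{\copyright m_i}\in F_{i-1}$ for some positive integer $m_i$. -}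

module Defs where

open import Algebra.Bundles using (Ring; CommutativeRing)
open import Algebra.Definitions using (Invertible)
open import Algebra.Morphism.Structures using (module RingMorphisms)
import Algebra.Properties.Monoid.Mult as Mult
import Algebra.Properties.Semiring.Exp as Exp
open import Data.List.Base using (List; []; _∷_; map; foldr)
open import Data.Nat.Base using (ℕ; zero; suc; _<_)
open import Data.Nat.Divisibility using (_∣_)
open import Data.Product.Base using (Σ-syntax; ∃-syntax)
open import Function.Base using (id; _∘_)
open import Function.Bundles using (_⇔_)
open import Level using (Level; _⊔_) renaming (suc to lsuc)
open import Relation.Binary.Construct.Closure.ReflexiveTransitive using (Star; ε; _◅_)
open import Relation.Nullary.Negation.Core using (¬_)

-- The library's HeytingField carries an apartness relation as extra data;
-- here a field has only ring structure, and nonzero means ≉ 0#.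
record Field (c ℓ : Level) : Set (lsuc (c ⊔ ℓ)) where
  field
    commutativeRing : CommutativeRing c ℓ
  open CommutativeRing commutativeRing public
  field
    1≉0        : ¬ (1# ≈ 0#)
    invertible : ∀ x → ¬ (x ≈ 0#) → Invertible _≈_ 1# _*_ x

-- Since n ∣ 0 for all n and 0 ∣ n only for n = 0, characteristic 0 is the
-- case in which no positive multiple of 1# vanishes.
HasCharacteristic : ∀ {c ℓ} → Field c ℓ → ℕ → Set ℓ
HasCharacteristic F p = ∀ n → (n × 1# ≈ 0#) ⇔ (p ∣ n)
  where
  open Field F
  open Mult +-monoid using (_×_)

module _ {c ℓ : Level} (R : Ring c ℓ) where
  open Ring R

  chebyshevPower : Carrier → ℕ → Carrier
  chebyshevPower x zero          = 1# + 1#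
  chebyshevPower x (suc zero)    = x
  chebyshevPower x (suc (suc n)) =
    x * chebyshevPower x (suc n) - chebyshevPower x n

-- A polynomial is its list of coefficients, constant term first; trailing
-- zeros are permitted, so equality is _≈ₚ_ rather than equality of lists.
module Polynomials {c ℓ : Level} (R : CommutativeRing c ℓ) where
  open CommutativeRing R

  Polynomial : Set c
  Polynomial = List Carrier

  coeff : Polynomial → ℕ → Carrier
  coeff []      _       = 0#
  coeff (a ∷ p) zero    = a
  coeff (a ∷ p) (suc n) = coeff p n

  infix 4 _≈ₚ_
  _≈ₚ_ : Polynomial → Polynomial → Set ℓ
  p ≈ₚ q = ∀ n → coeff p n ≈ coeff q n

  infixl 6 _+ₚ_
  _+ₚ_ : Polynomial → Polynomial → Polynomial
  []      +ₚ q       = q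
  (a ∷ p) +ₚ []      = a ∷ p
  (a ∷ p) +ₚ (b ∷ q) = (a + b) ∷ (p +ₚ q)

  infixr 7 _·ₚ_
  _·ₚ_ : Carrier → Polynomial → Polynomial
  a ·ₚ p = map (a *_) p

  infixl 7 _*ₚ_
  _*ₚ_ : Polynomial → Polynomial → Polynomial
  []      *ₚ q = []
  (a ∷ p) *ₚ q = (a ·ₚ q) +ₚ (0# ∷ (p *ₚ q))

  1ₚ : Polynomial
  1ₚ = 1# ∷ []

  X-_ : Carrier → Polynomial
  X- a = (- a) ∷ 1# ∷ []

  -- b · (X - a₁) ⋯ (X - aₖ). Constants, including zero, split with k = 0.
  Splits : Polynomial → Set (c ⊔ ℓ)
  Splits p = ∃[ b ] ∃[ as ] p ≈ₚ b ·ₚ foldr _*ₚ_ 1ₚ (map X-_ as)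

Polynomial : ∀ {c ℓ} → Field c ℓ → Set c
Polynomial F = Polynomials.Polynomial (Field.commutativeRing F)

Splits : ∀ {c ℓ} (F : Field c ℓ) → Polynomial F → Set (c ⊔ ℓ)
Splits F = Polynomials.Splits (Field.commutativeRing F)

record Extension {c ℓ : Level} (K L : Field c ℓ) : Set (c ⊔ ℓ) where
  private
    module K = Field K
    module L = Field L
  open RingMorphisms K.rawRing L.rawRing using (IsRingMonomorphism)
  field
    ⟦_⟧                : K.Carrier → L.Carrier
    isRingMonomorphism : IsRingMonomorphism ⟦_⟧

-- Membership in K(r), the subfield of L generated by the image of K and r.
-- The image of K already supplies 0# and 1#.
module _ {c ℓ : Level} {K L : Field c ℓ} (E : Extension K L) where
  private module K = Field K
  open Field L
  open Extension E

  data Adjoin (r : Carrier) : Carrier → Set (c ⊔ ℓ) where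
    base      : ∀ (a : K.Carrier) → Adjoin r ⟦ a ⟧
    generator : Adjoin r r
    add       : ∀ {x y} → Adjoin r x → Adjoin r y → Adjoin r (x + y)
    neg       : ∀ {x} → Adjoin r x → Adjoin r (- x)
    mul       : ∀ {x y} → Adjoin r x → Adjoin r y → Adjoin r (x * y)
    inv       : ∀ {x y} → x * y ≈ 1# → Adjoin r x → Adjoin r y
    resp      : ∀ {x y} → x ≈ y → Adjoin r x → Adjoin r y

PowerOperation : (c ℓ : Level) → Set (lsuc (c ⊔ ℓ))
PowerOperation c ℓ = (K : Field c ℓ) → Field.Carrier K → ℕ → Field.Carrier K

ordinaryPower : ∀ {c ℓ} → PowerOperation c ℓ
ordinaryPower K = _^_
  where open Exp (Field.semiring K) using (_^_)

chebyshev : ∀ {c ℓ} → PowerOperation c ℓ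
chebyshev K = chebyshevPower (Field.ring K)

record RadicalStep {c ℓ : Level} (pow : PowerOperation c ℓ)
                   (K L : Field c ℓ) : Set (c ⊔ ℓ) where
  private
    module K = Field K
    module L = Field L
  field
    extension : Extension K L
  open Extension extension public
  field
    r         : L.Carrier
    generates : ∀ x → Adjoin extension r x
    m         : ℕ
    0<m       : 0 < m
    radicand  : K.Carrier
    power     : pow L r m L.≈ ⟦ radicand ⟧

Tower : ∀ {c ℓ} → PowerOperation c ℓ → Field c ℓ → Field c ℓ → Set (lsuc (c ⊔ ℓ))
Tower pow = Star (RadicalStep pow)

embed : ∀ {c ℓ} {pow : PowerOperation c ℓ} {F K : Field c ℓ} →
        Tower pow F K → Field.Carrier F → Field.Carrier K
embed ε       = id
embed (s ◅ t) = embed t ∘ RadicalStep.⟦_⟧ s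

SolvableBy : ∀ {c ℓ} → PowerOperation c ℓ → (F : Field c ℓ) → Polynomial F →
             Set (lsuc (c ⊔ ℓ))
SolvableBy {c} {ℓ} pow F P =
  Σ[ K ∈ Field c ℓ ] Σ[ t ∈ Tower pow F K ] Splits K (map (embed t) P)

SolvableInRadicals : ∀ {c ℓ} (F : Field c ℓ) → Polynomial F → Set (lsuc (c ⊔ ℓ))
SolvableInRadicals = SolvableBy ordinaryPower

SolvableInChebyshevRadicals : ∀ {c ℓ} (F : Field c ℓ) → Polynomial F →
                              Set (lsuc (c ⊔ ℓ))
SolvableInChebyshevRadicals = SolvableBy chebyshev

{-# OPTIONS --safe #-}
module Submission where

-- Everything takes place in one large field Ω containing the top of the given
-- tower, and rests on the following identity: if z y = 1, then the m-th
-- Chebyshev power of z + y is z ^ m + y ^ m (chebyshevPower-sum).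
--
-- Radicals to Chebyshev radicals.  Let ω ≠ 0 with inverse y, and suppose that
-- ω ^ m lies in a subfield K of Ω.  Then the m-th Chebyshev power of ω + y lies
-- in K, so K(ω + y) is a Chebyshev step.  Since
-- (ω - y) ^ 2 = (ω + y) ^ 2 - 4, and the second Chebyshev power of x is
-- x ^ 2 - 2, adjoining ω - y is another one.  As 2 is invertible, the resulting
-- field contains ω (radical⇒chebyshev).  If ω = 0, there is nothing to adjoin.
-- Here Ω is the top of the given tower.
--
-- Chebyshev radicals to radicals.  Suppose that ω = z + y with z y = 1, and that
-- the m-th Chebyshev power of ω, that is w + v with w = z ^ m and v = y ^ m, lies
-- in K.  Since (w - v) ^ 2 = (w + v) ^ 2 - 4, adjoining w - v is a radical step;
-- as 2 is invertible, the field obtained contains w = z ^ m, so adjoining z is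
-- another one, and now ω = z + 1 / z has been reached (chebyshev⇒radical).  For every generator ω of
-- the given tower to be of the form z + 1 / z, Ω has to be larger than the top of
-- the tower: it is obtained from it by adjoining, one after another, roots of
-- the quadratics z ^ 2 - ω z + 1 where they are missing (reciprocalSumClosure).
--
-- In both directions, treating the generators one by one yields a tower of the
-- other kind inside Ω whose top contains the top of the given tower
-- (transfer), and a splitting of the polynomial can be carried over
-- (splits-descends).  Each intermediate field is some K(ω) inside Ω
-- (SimpleExtension).
--
-- Excluded middle is used to decide whether an element is zero, and whether a
-- quadratic has a root.

open import Defs
open import Algebra.Bundles using (AbelianGroup; CommutativeRing; RawRing)
open import Algebra.Construct.DirectProduct using (abelianGroup)
open import Algebra.Morphism.Structures using (module RingMorphisms)
import Algebra.Morphism.Construct.Composition as Composition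
import Algebra.Morphism.Construct.Identity as Identity
import Algebra.Morphism.RingMonomorphism as RingMonomorphism
import Algebra.Properties.CommutativeSemiring.Exp as Exp
import Algebra.Properties.Monoid.Mult as Mult
import Algebra.Properties.Ring as RingProperties
import Algebra.Solver.Ring.NaturalCoefficients.Default as SemiringSolver
open import Axiom.ExcludedMiddle using (ExcludedMiddle)
open import Data.List.Base using ([]; _∷_; map; foldr)
open import Data.List.Relation.Binary.Pointwise.Base using (Pointwise; []; _∷_)
open import Data.Nat.Base using (zero; suc; _<_; z<s)
open import Data.Nat.Divisibility using (_∣_; ∣m+n∣m⇒∣n; ∣-refl; _∣0; ∣m∣n⇒∣m+n; ∣1⇒≡1)
open import Data.Product.Base using (Σ-syntax; ∃-syntax; _×_; _,_; proj₁; proj₂)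
open import Data.Unit.Polymorphic.Base using (⊤; tt)
open import Function.Base using (_∘_)
open import Function.Bundles using (_⇔_; mk⇔)
open import Level using (Level; _⊔_; Lift; lift; lower) renaming (suc to lsuc)
open import Relation.Binary.Construct.Closure.ReflexiveTransitive using (ε; _◅_; _◅◅_)
open import Relation.Binary.PropositionalEquality.Core as ≡ using (_≡_)
import Relation.Binary.Reasoning.Setoid as SetoidReasoning
open import Relation.Nullary.Decidable.Core using (Dec; yes; no; map′)
open import Relation.Nullary.Negation.Core using (¬_; contradiction)

-- Identities in a field

module FieldIdentities {c ℓ : Level} (K : Field c ℓ) where
  open Field K
  open Exp commutativeSemiring
  open RingProperties ring
  open SemiringSolver commutativeSemiring
    using (solve; _:+_; _:*_; _:=_)
  open SetoidReasoning setoid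

  x+y-y≈x : ∀ x y → (x + y) - y ≈ x
  x+y-y≈x x y = begin
    (x + y) - y ≈⟨ +-assoc x y (- y) ⟩
    x + (y - y) ≈⟨ +-congˡ (-‿inverseʳ y) ⟩
    x + 0#      ≈⟨ +-identityʳ x ⟩
    x           ∎

  x-y+y≈x : ∀ x y → (x - y) + y ≈ x
  x-y+y≈x x y = begin
    (x - y) + y   ≈⟨ +-assoc x (- y) y ⟩
    x + (- y + y) ≈⟨ +-congˡ (-‿inverseˡ y) ⟩
    x + 0#        ≈⟨ +-identityʳ x ⟩
    x             ∎

  x≈y+z⇒x-z≈y : ∀ {x y z} → x ≈ y + z → x - z ≈ y
  x≈y+z⇒x-z≈y {y = y} {z} x≈y+z = trans (+-congʳ x≈y+z) (x+y-y≈x y z)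

  y+[x-y]≈x : ∀ x y → y + (x - y) ≈ x
  y+[x-y]≈x x y = trans (+-comm y (x - y)) (x-y+y≈x x y)

  x+y+[x-y]≈x+x : ∀ x y → (x + y) + (x - y) ≈ x + x
  x+y+[x-y]≈x+x x y = begin
    (x + y) + (x - y) ≈⟨ +-assoc x y (x - y) ⟩
    x + (y + (x - y)) ≈⟨ +-congˡ (y+[x-y]≈x x y) ⟩
    x + x             ∎

  inverse-power : ∀ {z y} → z * y ≈ 1# → ∀ n → z ^ n * y ^ n ≈ 1#
  inverse-power {z} {y} zy≈1 n = begin
    z ^ n * y ^ n ≈⟨ ^-distrib-* z y n ⟨
    (z * y) ^ n   ≈⟨ ^-congˡ n zy≈1 ⟩
    1# ^ n        ≈⟨ 1^n≈1 n ⟩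
    1#            ∎
    where
    1^n≈1 : ∀ n → 1# ^ n ≈ 1#
    1^n≈1 zero    = refl
    1^n≈1 (suc n) = trans (*-identityˡ (1# ^ n)) (1^n≈1 n)

  chebyshevPower-sum : ∀ {x z y} → z * y ≈ 1# → z + y ≈ x →
                       ∀ n → chebyshevPower ring x n ≈ z ^ n + y ^ n
  chebyshevPower-sum zy≈1 z+y≈x zero = refl
  chebyshevPower-sum {x} {z} {y} zy≈1 z+y≈x (suc zero) = begin
    x               ≈⟨ z+y≈x ⟨
    z + y           ≈⟨ +-cong (*-identityʳ z) (*-identityʳ y) ⟨
    z * 1# + y * 1# ∎
  chebyshevPower-sum {x} {z} {y} zy≈1 z+y≈x (suc (suc n)) =
    x≈y+z⇒x-z≈y (begin
      x * chebyshevPower ring x (suc n)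
        ≈⟨ *-cong (sym z+y≈x) (chebyshevPower-sum zy≈1 z+y≈x (suc n)) ⟩
      (z + y) * (z * z ^ n + y * y ^ n)
        ≈⟨ solve 4 (λ z y a b →
             (z :+ y) :* (z :* a :+ y :* b) :=
             (z :* (z :* a) :+ y :* (y :* b)) :+ (z :* y) :* (a :+ b))
             refl z y (z ^ n) (y ^ n) ⟩
      (z * (z * z ^ n) + y * (y * y ^ n)) + (z * y) * (z ^ n + y ^ n)
        ≈⟨ +-congˡ (trans (*-congʳ zy≈1) (*-identityˡ _)) ⟩
      (z * (z * z ^ n) + y * (y * y ^ n)) + (z ^ n + y ^ n)
        ≈⟨ +-congˡ (chebyshevPower-sum zy≈1 z+y≈x n) ⟨
      (z * (z * z ^ n) + y * (y * y ^ n)) + chebyshevPower ring x n ∎)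

  -- These are sums of 1#, as in the definition of the Chebyshev powers.
  2# 4# : Carrier
  2# = 1# + 1#
  4# = 2# + 2#

  square-of-difference : ∀ {z y} → z * y ≈ 1# →
                         (z - y) * (z - y) ≈ (z + y) * (z + y) - 4#
  square-of-difference {z} {y} zy≈1 = sym (x≈y+z⇒x-z≈y (begin
    (z + y) * (z + y)
      ≈⟨ *-cong (+-congʳ z≈d+y) (+-congʳ z≈d+y) ⟩
    ((d + y) + y) * ((d + y) + y)
      ≈⟨ solve 2 (λ d y → ((d :+ y) :+ y) :* ((d :+ y) :+ y) :=
           d :* d :+ (((d :+ y) :* y :+ (d :+ y) :* y) :+
                      ((d :+ y) :* y :+ (d :+ y) :* y))) refl d y ⟩
    d * d + (((d + y) * y + (d + y) * y) + ((d + y) * y + (d + y) * y))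
      ≈⟨ +-congˡ (+-cong (+-cong dy≈1 dy≈1) (+-cong dy≈1 dy≈1)) ⟩
    d * d + 4# ∎))
    where
    d : Carrier
    d = z - y
    z≈d+y : z ≈ d + y
    z≈d+y = sym (x-y+y≈x z y)
    dy≈1 : (d + y) * y ≈ 1#
    dy≈1 = trans (*-congʳ (sym z≈d+y)) zy≈1

  -- x is of the form z + 1 / z; the inverse y of z is part of the data.
  IsReciprocalSum : Carrier → Set (c ⊔ ℓ)
  IsReciprocalSum x = ∃[ z ] ∃[ y ] (z * y ≈ 1#) × (z + y ≈ x)

  -- The other root of the quadratic is r - t, and the product of the roots is 1.
  root⇒reciprocalSum : ∀ {r t} → t * t ≈ - 1# + r * t → IsReciprocalSum r
  root⇒reciprocalSum {r} {t} root = t , r - t , product , y+[x-y]≈x r t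
    where
    product : t * (r - t) ≈ 1#
    product = +-cancelʳ (- 1# + r * t) _ _ (begin
      t * (r - t) + (- 1# + r * t) ≈⟨ +-congˡ root ⟨
      t * (r - t) + t * t          ≈⟨ distribˡ t (r - t) t ⟨
      t * ((r - t) + t)            ≈⟨ *-congˡ (x-y+y≈x r t) ⟩
      t * r                        ≈⟨ *-comm t r ⟩
      r * t                        ≈⟨ +-identityˡ (r * t) ⟨
      0# + r * t                   ≈⟨ +-congʳ (-‿inverseʳ 1#) ⟨
      (1# - 1#) + r * t            ≈⟨ +-assoc 1# (- 1#) (r * t) ⟩
      1# + (- 1# + r * t)          ∎)

  halving : ∀ {h} → 2# * h ≈ 1# → ∀ x → h * (x + x) ≈ x
  halving {h} 2h≈1 x = begin
    h * (x + x)       ≈⟨ solve 2 (λ h x → h :* (x :+ x) := (h :+ h) :* x) refl h x ⟩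
    (h + h) * x       ≈⟨ *-congʳ (+-cong (*-identityˡ h) (*-identityˡ h)) ⟨
    (1# * h + 1# * h) * x ≈⟨ *-congʳ (distribʳ h 1# 1#) ⟨
    2# * h * x        ≈⟨ *-congʳ 2h≈1 ⟩
    1# * x            ≈⟨ *-identityˡ x ⟩
    x                 ∎

2≈0⇒characteristic2 : ∀ {c ℓ} (F : Field c ℓ) →
                      Field._≈_ F (FieldIdentities.2# F) (Field.0# F) →
                      HasCharacteristic F 2
2≈0⇒characteristic2 F 2≈0 n = mk⇔ (to n) (from n)
  where
  open Field F
  open Mult +-monoid using () renaming (_×_ to _·_)
  open SetoidReasoning setoid

  plus-two : ∀ n → suc (suc n) · 1# ≈ n · 1#
  plus-two n = begin
    1# + (1# + n · 1#) ≈⟨ +-assoc 1# 1# (n · 1#) ⟨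
    (1# + 1#) + n · 1# ≈⟨ +-congʳ 2≈0 ⟩
    0# + n · 1#        ≈⟨ +-identityˡ (n · 1#) ⟩
    n · 1#             ∎

  to : ∀ n → n · 1# ≈ 0# → 2 ∣ n
  to zero          _   = 2 ∣0
  to (suc zero)    1≈0 = contradiction (trans (sym (+-identityʳ 1#)) 1≈0) 1≉0
  to (suc (suc n)) n≈0 = ∣m∣n⇒∣m+n ∣-refl (to n (trans (sym (plus-two n)) n≈0))

  from : ∀ n → 2 ∣ n → n · 1# ≈ 0#
  from zero          _   = refl
  from (suc zero)    2∣1 with () ← ∣1⇒≡1 2∣1
  from (suc (suc n)) 2∣n =
    trans (plus-two n) (from n (∣m+n∣m⇒∣n 2∣n ∣-refl))

-- Extensions and their images

module _ {c ℓ : Level} where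

  module ExtensionHomo {K L : Field c ℓ} (E : Extension K L) where
    open Extension E public
    open RingMorphisms.IsRingMonomorphism isRingMonomorphism public

  idExtension : (K : Field c ℓ) → Extension K K
  idExtension K = record
    { isRingMonomorphism = Identity.isRingMonomorphism (Field.rawRing K) (Field.refl K) }

  infixr 9 _∘ₑ_
  _∘ₑ_ : {K L M : Field c ℓ} → Extension L M → Extension K L → Extension K M
  _∘ₑ_ {M = M} E D = record
    { isRingMonomorphism = Composition.isRingMonomorphism (Field.trans M)
        (Extension.isRingMonomorphism D) (Extension.isRingMonomorphism E) }

  towerExtension : ∀ {pow} {F K : Field c ℓ} → Tower pow F K → Extension F K
  towerExtension t = record { ⟦_⟧ = embed t ; isRingMonomorphism = mono t }
    where
    mono : ∀ {pow} {F K : Field c ℓ} (t : Tower pow F K) →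
           RingMorphisms.IsRingMonomorphism (Field.rawRing F) (Field.rawRing K) (embed t)
    mono {F = F} ε = Identity.isRingMonomorphism (Field.rawRing F) (Field.refl F)
    mono {K = K} (s ◅ t) = Composition.isRingMonomorphism (Field.trans K)
      (RadicalStep.isRingMonomorphism s) (mono t)

  embed-◅◅ : ∀ {pow} {F K L : Field c ℓ} (t : Tower pow F K) (u : Tower pow K L) →
             ∀ x → embed (t ◅◅ u) x ≡ embed u (embed t x)
  embed-◅◅ ε       u x = ≡.refl
  embed-◅◅ (s ◅ t) u x = embed-◅◅ t u (RadicalStep.⟦_⟧ s x)

  -- The power operation commutes with all embeddings of fields.
  IsNatural : PowerOperation c ℓ → Set (lsuc (c ⊔ ℓ))
  IsNatural pow = ∀ {K L : Field c ℓ} (E : Extension K L) x m →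
                  Field._≈_ L (Extension.⟦_⟧ E (pow K x m)) (pow L (Extension.⟦_⟧ E x) m)

  ordinaryPower-natural : IsNatural ordinaryPower
  ordinaryPower-natural E x zero = ExtensionHomo.1#-homo E
  ordinaryPower-natural {L = L} E x (suc m) =
    trans (*-homo x _) (*-congˡ (ordinaryPower-natural E x m))
    where
    open ExtensionHomo E
    open Field L

  chebyshev-natural : IsNatural chebyshev
  chebyshev-natural {L = L} E x zero =
    trans (+-homo _ _) (+-cong 1#-homo 1#-homo)
    where
    open ExtensionHomo E
    open Field L
  chebyshev-natural {L = L} E x (suc zero) = Field.refl L
  chebyshev-natural {L = L} E x (suc (suc m)) =
    trans (+-homo _ _) (+-cong
      (trans (*-homo x _) (*-congˡ (chebyshev-natural E x (suc m))))
      (trans (-‿homo _) (-‿cong (chebyshev-natural E x m))))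
    where
    open ExtensionHomo E
    open Field L

  module Image {K L : Field c ℓ} (E : Extension K L) where
    private module K = Field K
    open Field L
    open ExtensionHomo E
    open FieldIdentities L using (2#; 4#; halving)

    -- y lies in the image of K, regarded as a subfield of L.
    InImage : Carrier → Set (c ⊔ ℓ)
    InImage y = ∃[ x ] ⟦ x ⟧ ≈ y

    image-resp : ∀ {x y} → x ≈ y → InImage x → InImage y
    image-resp x≈y (a , p) = a , trans p x≈y

    image-0 : InImage 0#
    image-0 = K.0# , 0#-homo

    image-1 : InImage 1#
    image-1 = K.1# , 1#-homo

    image-+ : ∀ {x y} → InImage x → InImage y → InImage (x + y)
    image-+ (a , p) (b , q) = a K.+ b , trans (+-homo a b) (+-cong p q)

    image-* : ∀ {x y} → InImage x → InImage y → InImage (x * y)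
    image-* (a , p) (b , q) = a K.* b , trans (*-homo a b) (*-cong p q)

    image-neg : ∀ {x} → InImage x → InImage (- x)
    image-neg (a , p) = K.- a , trans (-‿homo a) (-‿cong p)

    image-inverse : ∀ {x y} → x * y ≈ 1# → InImage x → InImage y
    image-inverse {x} {y} xy≈1 (a , p) = b , (begin
      ⟦ b ⟧             ≈⟨ *-identityʳ _ ⟨
      ⟦ b ⟧ * 1#        ≈⟨ *-congˡ xy≈1 ⟨
      ⟦ b ⟧ * (x * y)   ≈⟨ *-assoc _ _ _ ⟨
      (⟦ b ⟧ * x) * y   ≈⟨ *-congʳ (*-congˡ p) ⟨
      (⟦ b ⟧ * ⟦ a ⟧) * y ≈⟨ *-congʳ (*-homo b a) ⟨
      ⟦ b K.* a ⟧ * y   ≈⟨ *-congʳ (⟦⟧-cong (proj₁ (proj₂ inverse))) ⟩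
      ⟦ K.1# ⟧ * y      ≈⟨ *-congʳ 1#-homo ⟩
      1# * y            ≈⟨ *-identityˡ y ⟩
      y                 ∎)
      where
      open SetoidReasoning setoid
      a≉0 : ¬ (a K.≈ K.0#)
      a≉0 a≈0 = 1≉0 (begin
        1#         ≈⟨ xy≈1 ⟨
        x * y      ≈⟨ *-congʳ (trans (sym p) (trans (⟦⟧-cong a≈0) 0#-homo)) ⟩
        0# * y     ≈⟨ zeroˡ y ⟩
        0#         ∎)
      inverse = K.invertible a a≉0
      b : K.Carrier
      b = proj₁ inverse

    image-2 : InImage 2#
    image-2 = image-+ image-1 image-1

    image-4 : InImage 4#
    image-4 = image-+ image-2 image-2

    image-half : ¬ (2# ≈ 0#) → ∀ {x} → InImage (x + x) → InImage x
    image-half 2≉0 {x} x+x∈ =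
      image-resp (halving 2h≈1 x) (image-* (image-inverse 2h≈1 image-2) x+x∈)
      where
      2h≈1 = proj₂ (proj₂ (invertible 2# 2≉0))

  reciprocalSum-map : {K L : Field c ℓ} (E : Extension K L) → ∀ {x} →
    FieldIdentities.IsReciprocalSum K x →
    FieldIdentities.IsReciprocalSum L (Extension.⟦_⟧ E x)
  reciprocalSum-map {L = L} E (z , y , zy≈1 , z+y≈x) =
    ⟦ z ⟧ , ⟦ y ⟧ ,
    trans (sym (*-homo z y)) (trans (⟦⟧-cong zy≈1) 1#-homo) ,
    trans (sym (+-homo z y)) (⟦⟧-cong z+y≈x)
    where
    open ExtensionHomo E
    open Field L

-- Splitting of polynomials over subfields

module _ {c ℓ : Level} {M L Ω : Field c ℓ} (D : Extension M Ω) (E : Extension L Ω) where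
  private
    module M = Field M
    module L = Field L
    module D = ExtensionHomo D
    module E = ExtensionHomo E
    module Mₚ = Polynomials M.commutativeRing
    module Lₚ = Polynomials L.commutativeRing
  open Field Ω

  -- x and y are the same element of Ω.  The relation is compatible with the ring
  -- operations, hence so is its extension to coefficient lists with the operations
  -- on polynomials.
  infix 4 _~_ _~ₚ_
  _~_ : M.Carrier → L.Carrier → Set ℓ
  x ~ y = D.⟦ x ⟧ ≈ E.⟦ y ⟧

  _~ₚ_ : Polynomial M → Polynomial L → Set (c ⊔ ℓ)
  _~ₚ_ = Pointwise _~_

  private
    ~-+ : ∀ {x y u v} → x ~ y → u ~ v → x M.+ u ~ y L.+ v
    ~-+ p q = trans (D.+-homo _ _) (trans (+-cong p q) (sym (E.+-homo _ _)))

    ~-* : ∀ {x y u v} → x ~ y → u ~ v → x M.* u ~ y L.* v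
    ~-* p q = trans (D.*-homo _ _) (trans (*-cong p q) (sym (E.*-homo _ _)))

    ~-neg : ∀ {x y} → x ~ y → M.- x ~ L.- y
    ~-neg p = trans (D.-‿homo _) (trans (-‿cong p) (sym (E.-‿homo _)))

    ~-0 : M.0# ~ L.0#
    ~-0 = trans D.0#-homo (sym E.0#-homo)

    ~-1 : M.1# ~ L.1#
    ~-1 = trans D.1#-homo (sym E.1#-homo)

    ~-+ₚ : ∀ {p q u v} → p ~ₚ q → u ~ₚ v → p Mₚ.+ₚ u ~ₚ q Lₚ.+ₚ v
    ~-+ₚ []      s       = s
    ~-+ₚ (a ∷ r) []      = a ∷ r
    ~-+ₚ (a ∷ r) (b ∷ s) = ~-+ a b ∷ ~-+ₚ r s

    ~-·ₚ : ∀ {a b p q} → a ~ b → p ~ₚ q → a Mₚ.·ₚ p ~ₚ b Lₚ.·ₚ q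
    ~-·ₚ a []      = []
    ~-·ₚ a (b ∷ r) = ~-* a b ∷ ~-·ₚ a r

    ~-*ₚ : ∀ {p q u v} → p ~ₚ q → u ~ₚ v → p Mₚ.*ₚ u ~ₚ q Lₚ.*ₚ v
    ~-*ₚ []      s = []
    ~-*ₚ (a ∷ r) s = ~-+ₚ (~-·ₚ a s) (~-0 ∷ ~-*ₚ r s)

    ~-linearFactors : ∀ {as bs} → Pointwise _~_ as bs →
      foldr Mₚ._*ₚ_ Mₚ.1ₚ (map Mₚ.X-_ as) ~ₚ foldr Lₚ._*ₚ_ Lₚ.1ₚ (map Lₚ.X-_ bs)
    ~-linearFactors []      = ~-1 ∷ []
    ~-linearFactors (a ∷ r) = ~-*ₚ (~-neg a ∷ ~-1 ∷ []) (~-linearFactors r)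

    ~-coeff : ∀ {p q} → p ~ₚ q → ∀ n → Mₚ.coeff p n ~ Lₚ.coeff q n
    ~-coeff []      n       = ~-0
    ~-coeff (a ∷ r) zero    = a
    ~-coeff (a ∷ r) (suc n) = ~-coeff r n

  -- A splitting over L is a splitting over M as soon as M contains L inside Ω; p
  -- and q are the same polynomial, with coefficients read in M and in L.
  splits-descends : (∀ y → Image.InImage D E.⟦ y ⟧) →
                    ∀ {p q} → p ~ₚ q → Splits L q → Splits M p
  splits-descends E⊆D {p} {q} p~q (b , bs , q≈) = a , as , λ n → D.injective (begin
    D.⟦ Mₚ.coeff p n ⟧ ≈⟨ ~-coeff p~q n ⟩
    E.⟦ Lₚ.coeff q n ⟧ ≈⟨ E.⟦⟧-cong (q≈ n) ⟩
    E.⟦ Lₚ.coeff (b Lₚ.·ₚ foldr Lₚ._*ₚ_ Lₚ.1ₚ (map Lₚ.X-_ bs)) n ⟧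
      ≈⟨ ~-coeff (~-·ₚ a~b (~-linearFactors as~bs)) n ⟨
    D.⟦ Mₚ.coeff (a Mₚ.·ₚ foldr Mₚ._*ₚ_ Mₚ.1ₚ (map Mₚ.X-_ as)) n ⟧ ∎)
    where
    open SetoidReasoning setoid
    a = proj₁ (E⊆D b)
    a~b = proj₂ (E⊆D b)
    as = map (proj₁ ∘ E⊆D) bs
    preimages : ∀ ys → Pointwise _~_ (map (proj₁ ∘ E⊆D) ys) ys
    preimages []       = []
    preimages (y ∷ ys) = proj₂ (E⊆D y) ∷ preimages ys
    as~bs = preimages bs

-- Adjoining one element

-- The constructions that rely on excluded middle, and what is built on them.
module Classical {c ℓ : Level} (em : ExcludedMiddle (c ⊔ ℓ)) where

  module _ (K : Field c ℓ) where
    open Field K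

    ≈-dec : ∀ x y → Dec (x ≈ y)
    ≈-dec x y = map′ lower lift (em {Lift c (x ≈ y)})

    -- Inversion made total by sending zero to zero.
    totalInverse : ∀ x → ∃[ y ] (x ≈ 0# → y ≈ 0#) × (¬ (x ≈ 0#) → x * y ≈ 1#)
    totalInverse x with ≈-dec x 0#
    ... | yes x≈0 = 0# , (λ _ → refl) , λ x≉0 → contradiction x≈0 x≉0
    ... | no  x≉0 =
      proj₁ (invertible x x≉0) ,
      (λ x≈0 → contradiction x≈0 x≉0) ,
      λ _ → proj₂ (proj₂ (invertible x x≉0))

  -- The subfield K(ω) of Ω.  Its elements are formal expressions in ω with
  -- constants from K, and two expressions are equal if they have the same value
  -- in Ω.  Pairs of an element of Ω and a proof that it lies in K(ω) would be too
  -- large: for ℓ above c they do not form a set at level c.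
  module SimpleExtension {K Ω : Field c ℓ} (E : Extension K Ω) (ω : Field.Carrier Ω) where
    private module K = Field K
    open Field Ω hiding (rawRing)
    open ExtensionHomo E

    data Expression : Set c where
      const     : K.Carrier → Expression
      adjoined  : Expression
      _⊕_ _⊗_   : Expression → Expression → Expression
      ⊖_ recip  : Expression → Expression

    -- The value of an expression in Ω; recip of a zero expression has value zero.
    eval : Expression → Carrier
    eval (const a)  = ⟦ a ⟧
    eval adjoined   = ω
    eval (e ⊕ f)    = eval e + eval f
    eval (e ⊗ f)    = eval e * eval f
    eval (⊖ e)      = - eval e
    eval (recip e)  = proj₁ (totalInverse Ω (eval e))

    rawRing : RawRing c ℓ
    rawRing = record
      { Carrier = Expression
      ; _≈_     = λ e f → eval e ≈ eval f
      ; _+_     = _⊕_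
      ; _*_     = _⊗_
      ; -_      = ⊖_
      ; 0#      = const K.0#
      ; 1#      = const K.1#
      }

    module Eval = RingMorphisms rawRing (Field.rawRing Ω)

    eval-isRingMonomorphism : Eval.IsRingMonomorphism eval
    eval-isRingMonomorphism = record
      { isRingHomomorphism = record
        { isSemiringHomomorphism = record
          { isNearSemiringHomomorphism = record
            { +-isMonoidHomomorphism = record
              { isMagmaHomomorphism = record
                { isRelHomomorphism = record { cong = λ p → p }
                ; homo = λ _ _ → refl }
              ; ε-homo = 0#-homo }
            ; *-homo = λ _ _ → refl }
          ; 1#-homo = 1#-homo }
        ; -‿homo = λ _ → refl }
      ; injective = λ p → p }

    simpleExtension : Field c ℓ
    simpleExtension = record
      { commutativeRing = record
        { isCommutativeRing =
            RingMonomorphism.isCommutativeRing eval-isRingMonomorphism isCommutativeRing }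
      ; 1≉0 = λ 1≈0 → 1≉0 (trans (sym 1#-homo) (trans 1≈0 0#-homo))
      ; invertible = λ e e≉0 →
          let inverse = trans (proj₂ (proj₂ (totalInverse Ω (eval e)))
                                 λ e≈0 → e≉0 (trans e≈0 (sym 0#-homo)))
                              (sym 1#-homo)
          in recip e , trans (*-comm _ _) inverse , inverse
      }

    inclusion : Extension K simpleExtension
    inclusion = record
      { ⟦_⟧ = const
      ; isRingMonomorphism = record
        { isRingHomomorphism = record
          { isSemiringHomomorphism = record
            { isNearSemiringHomomorphism = record
              { +-isMonoidHomomorphism = record
                { isMagmaHomomorphism = record
                  { isRelHomomorphism = record { cong = ⟦⟧-cong }
                  ; homo = +-homo }
                ; ε-homo = refl }
              ; *-homo = *-homo }
            ; 1#-homo = refl }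
          ; -‿homo = -‿homo }
        ; injective = injective } }

    evaluation : Extension simpleExtension Ω
    evaluation = record { isRingMonomorphism = eval-isRingMonomorphism }

    adjoined-generates : ∀ e → Adjoin inclusion adjoined e
    adjoined-generates (const a) = base a
    adjoined-generates adjoined  = generator
    adjoined-generates (e ⊕ f)   = add (adjoined-generates e) (adjoined-generates f)
    adjoined-generates (e ⊗ f)   = mul (adjoined-generates e) (adjoined-generates f)
    adjoined-generates (⊖ e)     = neg (adjoined-generates e)
    adjoined-generates (recip e) with ≈-dec Ω (eval e) 0#
    ... | yes e≈0 = resp
      (trans 0#-homo (sym (proj₁ (proj₂ (totalInverse Ω (eval e))) e≈0))) (base K.0#)
    ... | no  e≉0 = inv
      (trans (proj₂ (proj₂ (totalInverse Ω (eval e))) e≉0) (sym 1#-homo))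
      (adjoined-generates e)

    -- Given ω ^ m in K (for the power operation pow), K(ω) is a step over K.
    radicalStep : ∀ {pow : PowerOperation c ℓ} → IsNatural pow → ∀ m → 0 < m →
                  Image.InImage E (pow Ω ω m) → RadicalStep pow K simpleExtension
    radicalStep natural m 0<m (a , p) = record
      { extension = inclusion
      ; r         = adjoined
      ; generates = adjoined-generates
      ; m         = m
      ; 0<m       = 0<m
      ; radicand  = a
      ; power     = trans (natural evaluation adjoined m) (sym p)
      }

  -- Quadratic extensions

  -- The field K[X] / (X ^ 2 - r X - q), for a quadratic without roots in K.  The
  -- pair (a , b) stands for a + b X, and _⊛_ is multiplication of such pairs.
  module QuadraticExtension (K : Field c ℓ) (q r : Field.Carrier K)
    (irreducible : ¬ (∃[ t ] Field._≈_ K (Field._*_ K t t)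
                          (Field._+_ K q (Field._*_ K r t)))) where
    open Field K
    open RingProperties ring
    open SemiringSolver commutativeSemiring
      using (solve; _:+_; _:*_; _:=_)
    open SetoidReasoning setoid

    private module Pairs = AbelianGroup (abelianGroup +-abelianGroup +-abelianGroup)

    infixl 7 _⊛_
    _⊛_ : Carrier × Carrier → Carrier × Carrier → Carrier × Carrier
    (a , b) ⊛ (u , v) = a * u + q * (b * v) , (a * v + b * u) + r * (b * v)

    ring′ : CommutativeRing c ℓ
    ring′ = record
      { Carrier = Carrier × Carrier
      ; _≈_ = Pairs._≈_
      ; _+_ = Pairs._∙_
      ; _*_ = _⊛_
      ; -_  = Pairs._⁻¹
      ; 0#  = Pairs.ε
      ; 1#  = 1# , 0#
      ; isCommutativeRing = record
        { isRing = record
          { +-isAbelianGroup = Pairs.isAbelianGroup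
          ; *-cong = λ (p , q) (s , t) →
              +-cong (*-cong p s) (*-congˡ (*-cong q t)) ,
              +-cong (+-cong (*-cong p t) (*-cong q s)) (*-congˡ (*-cong q t))
          ; *-assoc = assoc′
          ; *-identity = identityˡ′ ,
              λ x → Pairs.trans (comm′ x (1# , 0#)) (identityˡ′ x)
          ; distrib = distribˡ′ ,
              λ x y z → Pairs.trans (comm′ (y Pairs.∙ z) x)
                (Pairs.trans (distribˡ′ x y z) (Pairs.∙-cong (comm′ x y) (comm′ x z)))
          }
        ; *-comm = comm′
        }
      }
      where
      assoc′ : ∀ x y z → (x ⊛ y) ⊛ z Pairs.≈ x ⊛ (y ⊛ z)
      assoc′ (a , b) (u , v) (s , t) =
        solve 8 (λ q r a b u v s t →
          (a :* u :+ q :* (b :* v)) :* s :+ q :* (((a :* v :+ b :* u) :+ r :* (b :* v)) :* t) :=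
          a :* (u :* s :+ q :* (v :* t)) :+ q :* (b :* ((u :* t :+ v :* s) :+ r :* (v :* t))))
          refl q r a b u v s t ,
        solve 8 (λ q r a b u v s t →
          ((a :* u :+ q :* (b :* v)) :* t :+ ((a :* v :+ b :* u) :+ r :* (b :* v)) :* s)
            :+ r :* (((a :* v :+ b :* u) :+ r :* (b :* v)) :* t) :=
          (a :* ((u :* t :+ v :* s) :+ r :* (v :* t)) :+ b :* (u :* s :+ q :* (v :* t)))
            :+ r :* (b :* ((u :* t :+ v :* s) :+ r :* (v :* t))))
          refl q r a b u v s t
      comm′ : ∀ x y → x ⊛ y Pairs.≈ y ⊛ x
      comm′ (a , b) (u , v) =
        solve 5 (λ q a b u v → a :* u :+ q :* (b :* v) := u :* a :+ q :* (v :* b))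
          refl q a b u v ,
        solve 5 (λ r a b u v → (a :* v :+ b :* u) :+ r :* (b :* v) :=
          (u :* b :+ v :* a) :+ r :* (v :* b)) refl r a b u v
      identityˡ′ : ∀ x → (1# , 0#) ⊛ x Pairs.≈ x
      identityˡ′ (u , v) =
        trans (+-cong (*-identityˡ u) (trans (*-congˡ (zeroˡ v)) (zeroʳ q))) (+-identityʳ u) ,
        trans (+-cong (trans (+-cong (*-identityˡ v) (zeroˡ u)) (+-identityʳ v))
                      (trans (*-congˡ (zeroˡ v)) (zeroʳ r)))
              (+-identityʳ v)
      distribˡ′ : ∀ x y z → x ⊛ (y Pairs.∙ z) Pairs.≈ (x ⊛ y) Pairs.∙ (x ⊛ z)
      distribˡ′ (a , b) (u , v) (s , t) =
        solve 7 (λ q a b u v s t →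
          a :* (u :+ s) :+ q :* (b :* (v :+ t)) :=
          (a :* u :+ q :* (b :* v)) :+ (a :* s :+ q :* (b :* t)))
          refl q a b u v s t ,
        solve 7 (λ r a b u v s t →
          (a :* (v :+ t) :+ b :* (u :+ s)) :+ r :* (b :* (v :+ t)) :=
          ((a :* v :+ b :* u) :+ r :* (b :* v)) :+ ((a :* t :+ b :* s) :+ r :* (b :* t)))
          refl r a b u v s t

    -- The other root of the quadratic is r - X, so a + b X has conjugate
    -- (a + r b) - b X.
    conjugate : Carrier × Carrier → Carrier × Carrier
    conjugate (a , b) = a + r * b , - b

    -- The product of x and its conjugate has no X-component (⊛-conjugate); the
    -- norm is the other component.
    norm : Carrier × Carrier → Carrier
    norm x = proj₁ (x ⊛ conjugate x)

    ⊛-conjugate : ∀ x → proj₂ (x ⊛ conjugate x) ≈ 0#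
    ⊛-conjugate (a , b) = begin
      (a * - b + b * (a + r * b)) + r * (b * - b)
        ≈⟨ solve 4 (λ a b e r → (a :* e :+ b :* (a :+ r :* b)) :+ r :* (b :* e) :=
             (a :+ r :* b) :* (b :+ e)) refl a b (- b) r ⟩
      (a + r * b) * (b - b) ≈⟨ *-congˡ (-‿inverseʳ b) ⟩
      (a + r * b) * 0#      ≈⟨ zeroʳ _ ⟩
      0#                    ∎

    -- If b ≠ 0 and the norm of a + b X vanishes, then - a / b is a root of the
    -- quadratic; if b = 0, then the norm is a ^ 2.
    norm≉0 : ∀ x → ¬ (x Pairs.≈ Pairs.ε) → ¬ (norm x ≈ 0#)
    norm≉0 (a , b) x≉0 N≈0 with ≈-dec K b 0#
    -- For t = - a / b, computed as a s with s the inverse of - b, the product of the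
    -- norm and s ^ 2 is t ^ 2 - r t - q.  The semiring solver treats - b as an
    -- independent variable; the zero term with factor b - b corrects for this.
    ... | no b≉0 = irreducible (t , (begin
      t * t
        ≈⟨ +-identityʳ _ ⟨
      t * t + 0#
        ≈⟨ +-congˡ (trans (*-congʳ (-‿inverseʳ b)) (zeroˡ _)) ⟨
      t * t + (b - b) * (s * (q * (- b * s) + r * t))
        ≈⟨ solve 6 (λ a b e s q r →
             (a :* s) :* (a :* s)
               :+ (b :+ e) :* (s :* (q :* (e :* s) :+ r :* (a :* s))) :=
             (a :* (a :+ r :* b) :+ q :* (b :* e)) :* (s :* s)
               :+ (q :* (e :* s) :+ r :* (a :* s)) :* (e :* s))
             refl a b (- b) s q r ⟩
      norm (a , b) * (s * s) + (q * (- b * s) + r * t) * (- b * s)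
        ≈⟨ +-cong (*-congʳ N≈0) (*-cong (+-congʳ (*-congˡ -bs≈1)) -bs≈1) ⟩
      0# * (s * s) + (q * 1# + r * t) * 1#
        ≈⟨ +-cong (zeroˡ _) (*-identityʳ _) ⟩
      0# + (q * 1# + r * t)
        ≈⟨ +-identityˡ _ ⟩
      q * 1# + r * t
        ≈⟨ +-congʳ (*-identityʳ q) ⟩
      q + r * t ∎))
      where
      -b≉0 : ¬ (- b ≈ 0#)
      -b≉0 -b≈0 = b≉0 (trans (sym (-‿involutive b)) (trans (-‿cong -b≈0) -0#≈0#))
      s t : Carrier
      s = proj₁ (invertible (- b) -b≉0)
      t = a * s
      -bs≈1 : - b * s ≈ 1#
      -bs≈1 = proj₂ (proj₂ (invertible (- b) -b≉0))
    ... | yes b≈0 with ≈-dec K a 0#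
    ...   | yes a≈0 = x≉0 (a≈0 , b≈0)
    ...   | no  a≉0 = a≉0 (begin
      a             ≈⟨ *-identityʳ a ⟨
      a * 1#        ≈⟨ *-congˡ (proj₂ (proj₂ (invertible a a≉0))) ⟨
      a * (a * s)   ≈⟨ *-assoc a a s ⟨
      (a * a) * s   ≈⟨ *-congʳ a²≈0 ⟩
      0# * s        ≈⟨ zeroˡ s ⟩
      0#            ∎)
      where
      s : Carrier
      s = proj₁ (invertible a a≉0)
      a²≈0 : a * a ≈ 0#
      a²≈0 = begin
        a * a
          ≈⟨ +-identityʳ _ ⟨
        a * a + 0#
          ≈⟨ +-congˡ (trans (*-congʳ b≈0) (zeroˡ _)) ⟨
        a * a + b * (a * r + q * - b)
          ≈⟨ solve 5 (λ a b e q r → a :* a :+ b :* (a :* r :+ q :* e) :=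
               a :* (a :+ r :* b) :+ q :* (b :* e)) refl a b (- b) q r ⟩
        norm (a , b)
          ≈⟨ N≈0 ⟩
        0# ∎

    quadraticField : Field c ℓ
    quadraticField = record
      { commutativeRing = ring′
      ; 1≉0 = λ 1≈0 → 1≉0 (proj₁ 1≈0)
      ; invertible = λ x x≉0 →
          let y = proj₁ (inverse x x≉0)
              xy≈1 = proj₂ (inverse x x≉0)
          in y , Pairs.trans (R.*-comm y x) xy≈1 , xy≈1
      }
      where
      module R = CommutativeRing ring′
      -- The conjugate divided by the norm.
      inverse : ∀ x → ¬ (x Pairs.≈ Pairs.ε) → ∃[ y ] x ⊛ y R.≈ R.1#
      inverse x x≉0 = conjugate x ⊛ (s , 0#) ,
        R.trans (R.sym (R.*-assoc x (conjugate x) (s , 0#)))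
          ( trans (+-cong (proj₂ (proj₂ (invertible (norm x) N≉0)))
                          (trans (*-congˡ (zeroʳ _)) (zeroʳ q)))
                  (+-identityʳ 1#)
          , trans (+-cong (trans (+-cong (zeroʳ _) (trans (*-congʳ (⊛-conjugate x)) (zeroˡ s)))
                                 (+-identityʳ 0#))
                          (trans (*-congˡ (zeroʳ _)) (zeroʳ r)))
                  (+-identityʳ 0#) )
        where
        N≉0 : ¬ (norm x ≈ 0#)
        N≉0 = norm≉0 x x≉0
        s : Carrier
        s = proj₁ (invertible (norm x) N≉0)

    quadraticInclusion : Extension K quadraticField
    quadraticInclusion = record
      { ⟦_⟧ = _, 0#
      ; isRingMonomorphism = record
        { isRingHomomorphism = record
          { isSemiringHomomorphism = record
            { isNearSemiringHomomorphism = record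
              { +-isMonoidHomomorphism = record
                { isMagmaHomomorphism = record
                  { isRelHomomorphism = record { cong = λ p → p , refl }
                  ; homo = λ _ _ → refl , sym (+-identityʳ 0#) }
                ; ε-homo = refl , refl }
              ; *-homo = λ x y →
                  sym (trans (+-congˡ (trans (*-congˡ (zeroˡ 0#)) (zeroʳ q))) (+-identityʳ _)) ,
                  sym (trans (+-cong (trans (+-cong (zeroʳ x) (zeroˡ y)) (+-identityʳ 0#))
                                     (trans (*-congˡ (zeroˡ 0#)) (zeroʳ r)))
                             (+-identityʳ 0#)) }
            ; 1#-homo = refl , refl }
          ; -‿homo = λ _ → refl , sym -0#≈0# }
        ; injective = proj₁ } }

    root : Field.Carrier quadraticField
    root = 0# , 1#

    root-equation : root ⊛ root Pairs.≈ (q , 0#) Pairs.∙ ((r , 0#) ⊛ root)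
    root-equation =
      (begin
        0# * 0# + q * (1# * 1#)       ≈⟨ +-cong (zeroˡ 0#) (*-congˡ (*-identityˡ 1#)) ⟩
        0# + q * 1#                   ≈⟨ +-identityˡ _ ⟩
        q * 1#                        ≈⟨ *-identityʳ q ⟩
        q                             ≈⟨ +-identityʳ q ⟨
        q + 0#                        ≈⟨ +-congˡ (+-identityʳ 0#) ⟨
        q + (0# + 0#)                 ≈⟨ +-congˡ (+-cong (zeroʳ r) (trans (*-congˡ (zeroˡ 1#)) (zeroʳ q))) ⟨
        q + (r * 0# + q * (0# * 1#))  ∎) ,
      (begin
        (0# * 1# + 1# * 0#) + r * (1# * 1#)
          ≈⟨ +-cong (trans (+-cong (zeroˡ 1#) (zeroʳ 1#)) (+-identityˡ 0#))
                    (*-congˡ (*-identityˡ 1#)) ⟩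
        0# + r * 1#
          ≈⟨ +-congˡ (+-identityʳ _) ⟨
        0# + (r * 1# + 0#)
          ≈⟨ +-congˡ (+-cong (trans (+-congˡ (zeroˡ 0#)) (+-identityʳ _))
                             (trans (*-congˡ (zeroˡ 1#)) (zeroʳ r))) ⟨
        0# + ((r * 1# + 0# * 0#) + r * (0# * 1#)) ∎)

  -- Every element r of K is of the form z + 1 / z in K itself or in a quadratic
  -- extension: z is a root of z ^ 2 - r z + 1.
  reciprocalSumExtension : (K : Field c ℓ) (r : Field.Carrier K) →
    Σ[ L ∈ Field c ℓ ] Σ[ E ∈ Extension K L ]
      FieldIdentities.IsReciprocalSum L (Extension.⟦_⟧ E r)
  reciprocalSumExtension K r = split em
    where
    open Field K
    HasRoot : Set (c ⊔ ℓ)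
    HasRoot = ∃[ t ] t * t ≈ - 1# + r * t
    split : Dec HasRoot →
      Σ[ L ∈ Field c ℓ ] Σ[ E ∈ Extension K L ]
        FieldIdentities.IsReciprocalSum L (Extension.⟦_⟧ E r)
    split (yes (t , t-root)) =
      K , idExtension K , FieldIdentities.root⇒reciprocalSum K t-root
    split (no irreducible) =
      quadraticField , quadraticInclusion ,
      FieldIdentities.root⇒reciprocalSum quadraticField {r = r , 0#} {t = root}
        (L.trans root-equation (L.+-congʳ { (r , 0#) L.* root } (-‿homo 1#)))
      where
      open QuadraticExtension K (- 1#) r irreducible
      open ExtensionHomo quadraticInclusion using (-‿homo)
      module L = Field quadraticField

  -- Transferring towers inside a large field

  -- A tower of steps for pow that starts at K and lies inside Ω over K: its top is
  -- embedded in Ω by an extension that restricts to E on K.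
  record TowerIn (pow : PowerOperation c ℓ) {K Ω : Field c ℓ} (E : Extension K Ω)
                 : Set (lsuc (c ⊔ ℓ)) where
    private module Ω = Field Ω
    field
      {top}    : Field c ℓ
      tower    : Tower pow K top
      inside   : Extension top Ω
      commutes : ∀ x → Extension.⟦_⟧ inside (embed tower x) Ω.≈ Extension.⟦_⟧ E x

    -- The element of Ω lies in the top of the tower.
    open Image inside public using () renaming (InImage to Reaches)

    reaches-base : ∀ {y} → Image.InImage E y → Reaches y
    reaches-base (x , p) = embed tower x , Ω.trans (commutes x) p

  module _ {pow : PowerOperation c ℓ} {K Ω : Field c ℓ} {E : Extension K Ω} where
    open TowerIn

    trivialTower : TowerIn pow E
    trivialTower = record { tower = ε ; inside = E ; commutes = λ _ → Field.refl Ω }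

    extendTower : (S : TowerIn pow E) → TowerIn pow (inside S) → TowerIn pow E
    extendTower S S′ = record
      { tower    = tower S ◅◅ tower S′
      ; inside   = inside S′
      ; commutes = λ x → Ω.trans
          (ExtensionHomo.⟦⟧-cong (inside S′)
            (Field.reflexive (top S′) (embed-◅◅ (tower S) (tower S′) x)))
          (Ω.trans (commutes S′ (embed (tower S) x)) (commutes S x))
      }
      where module Ω = Field Ω

  -- ω lies in the top of some tower over K inside Ω.
  Reachable : PowerOperation c ℓ → {K Ω : Field c ℓ} → Extension K Ω →
              Field.Carrier Ω → Set (lsuc (c ⊔ ℓ))
  Reachable pow E ω = Σ[ S ∈ TowerIn pow E ] TowerIn.Reaches S ω

  reachable-power : ∀ {pow : PowerOperation c ℓ} → IsNatural pow →
    ∀ {K Ω} (E : Extension K Ω) ω m → 0 < m →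
    Image.InImage E (pow Ω ω m) → Reachable pow E ω
  reachable-power natural {Ω = Ω} E ω m 0<m p = record
    { tower    = radicalStep natural m 0<m p ◅ ε
    ; inside   = evaluation
    ; commutes = λ _ → Field.refl Ω
    } , adjoined , Field.refl Ω
    where open SimpleExtension E ω

  module _ {Ω : Field c ℓ} where
    open Field Ω

    -- Viewed in Ω, the generators of all steps of the tower satisfy G.
    GeneratorsSatisfy : ∀ {pow} {K L : Field c ℓ} → (Carrier → Set (c ⊔ ℓ)) →
                        Tower pow K L → Extension L Ω → Set (c ⊔ ℓ)
    GeneratorsSatisfy G ε       E = ⊤
    GeneratorsSatisfy G (s ◅ t) E =
      G (Extension.⟦_⟧ E (embed t (RadicalStep.r s))) × GeneratorsSatisfy G t E

    -- If the field M contains K and r inside Ω, then it contains K(r).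
    adjoin⊆image : ∀ {K L M : Field c ℓ} (F : Extension K L) (E : Extension L Ω)
      (D : Extension M Ω) {r} →
      (∀ a → Image.InImage D (Extension.⟦_⟧ E (Extension.⟦_⟧ F a))) →
      Image.InImage D (Extension.⟦_⟧ E r) →
      ∀ {y} → Adjoin F r y → Image.InImage D (Extension.⟦_⟧ E y)
    adjoin⊆image {L = L} F E D {r} K⊆D r∈D = go
      where
      module L = Field L
      open ExtensionHomo E
      open Image D
      go : ∀ {y} → Adjoin F r y → InImage ⟦ y ⟧
      go (base a)    = K⊆D a
      go generator   = r∈D
      go (add x y)   = image-resp (sym (+-homo _ _)) (image-+ (go x) (go y))
      go (neg x)     = image-resp (sym (-‿homo _)) (image-neg (go x))
      go (mul x y)   = image-resp (sym (*-homo _ _)) (image-* (go x) (go y))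
      go (inv p x)   = image-inverse
        (trans (sym (*-homo _ _)) (trans (⟦⟧-cong p) 1#-homo)) (go x)
      go (resp p x)  = image-resp (⟦⟧-cong p) (go x)

    -- Towers for pow whose generators satisfy G become towers for pow′, provided that
    -- a single such generator can be reached by a tower for pow′ inside Ω.
    module Transfer {pow pow′ : PowerOperation c ℓ} (natural : IsNatural pow)
      (G : Carrier → Set (c ⊔ ℓ))
      (translate : ∀ {K} (E : Extension K Ω) ω m → G ω → 0 < m →
                   Image.InImage E (pow Ω ω m) → Reachable pow′ E ω) where

      -- The new tower starts at M, which contains the bottom K of t inside Ω, and its
      -- top contains the top L of t.  The larger M is needed for the induction: after
      -- one step, the new tower has reached a field that contains K(r) but may differ
      -- from it.
      transfer : ∀ {K L M : Field c ℓ} (t : Tower pow K L) (E : Extension L Ω)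
        (D : Extension M Ω) → GeneratorsSatisfy G t E →
        (∀ x → Image.InImage D (Extension.⟦_⟧ E (embed t x))) →
        Σ[ S ∈ TowerIn pow′ D ] (∀ y → TowerIn.Reaches S (Extension.⟦_⟧ E y))
      transfer ε       E D _        K⊆D = trivialTower , K⊆D
      transfer (s ◅ t) E D (g , gs) K⊆D = extendTower S S′ , L⊆S′
        where
        open RadicalStep s using (r; m; 0<m; radicand; power; generates; extension)
        E₁ = E ∘ₑ towerExtension t
        r-reachable : Reachable pow′ D (Extension.⟦_⟧ E₁ r)
        r-reachable = translate D _ m g 0<m
          (Image.image-resp D (trans (sym (ExtensionHomo.⟦⟧-cong E₁ power)) (natural E₁ r m))
            (K⊆D radicand))
        S = proj₁ r-reachable
        rest = transfer t E (TowerIn.inside S) gs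
          (λ x → adjoin⊆image extension E₁ (TowerIn.inside S)
            (λ a → TowerIn.reaches-base S (K⊆D a)) (proj₂ r-reachable) (generates x))
        S′ = proj₁ rest
        L⊆S′ = proj₂ rest

      solvable : ∀ {F K : Field c ℓ} (t : Tower pow F K) (E : Extension K Ω) →
        GeneratorsSatisfy G t E →
        ∀ P → Splits K (map (embed t) P) → SolvableBy pow′ F P
      solvable t E gs P P-splits =
        TowerIn.top S , TowerIn.tower S ,
        splits-descends (TowerIn.inside S) E (proj₂ image) (related P) P-splits
        where
        D = E ∘ₑ towerExtension t
        image = transfer t E D gs (λ x → x , refl)
        S = proj₁ image
        related : ∀ P → Pointwise (_~_ (TowerIn.inside S) E)
                          (map (embed (TowerIn.tower S)) P) (map (embed t) P)
        related []      = []
        related (a ∷ P) = TowerIn.commutes S a ∷ related P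

  -- Reaching radicals by Chebyshev radicals, and conversely

  module _ {Ω : Field c ℓ} where
    open Field Ω
    open FieldIdentities Ω
    open Exp commutativeSemiring using (_^_)

    radical⇒chebyshev : ¬ (2# ≈ 0#) → ∀ {K} (E : Extension K Ω) ω m → 0 < m →
      Image.InImage E (ω ^ m) → Reachable chebyshev E ω
    radical⇒chebyshev 2≉0 E ω m 0<m ω^m∈ with ≈-dec Ω ω 0#
    ... | yes ω≈0 = trivialTower , Image.image-resp E (sym ω≈0) (Image.image-0 E)
    ... | no  ω≉0 = extendTower S T , ω∈
      where
      y : Carrier
      y = proj₁ (invertible ω ω≉0)
      ωy≈1 : ω * y ≈ 1#
      ωy≈1 = proj₂ (proj₂ (invertible ω ω≉0))
      -- The m-th Chebyshev power of ω + y is ω ^ m + y ^ m.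
      sum = reachable-power chebyshev-natural E (ω + y) m 0<m
        (Image.image-resp E (sym (chebyshevPower-sum ωy≈1 refl m))
          (Image.image-+ E ω^m∈ (Image.image-inverse E (inverse-power ωy≈1 m) ω^m∈)))
      S = proj₁ sum
      module S = Image (TowerIn.inside S)
      -- The second Chebyshev power of ω - y is (ω + y) ^ 2 - 4 - 2.
      difference = reachable-power chebyshev-natural (TowerIn.inside S) (ω - y) 2 z<s
        (S.image-resp (+-congʳ (sym (square-of-difference ωy≈1)))
          (S.image-+ (S.image-+ (S.image-* (proj₂ sum) (proj₂ sum)) (S.image-neg S.image-4))
                     (S.image-neg S.image-2)))
      T = proj₁ difference
      module T = Image (TowerIn.inside T)
      ω∈ : T.InImage ω
      ω∈ = T.image-half 2≉0 (T.image-resp (x+y+[x-y]≈x+x ω y)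
        (T.image-+ (TowerIn.reaches-base T (proj₂ sum)) (proj₂ difference)))

    chebyshev⇒radical : ¬ (2# ≈ 0#) → ∀ {K} (E : Extension K Ω) ω m →
      IsReciprocalSum ω → 0 < m →
      Image.InImage E (chebyshevPower ring ω m) → Reachable ordinaryPower E ω
    chebyshev⇒radical 2≉0 E ω m (z , y , zy≈1 , z+y≈ω) 0<m ω^m∈ =
      extendTower S T ,
      T.image-resp z+y≈ω (T.image-+ (proj₂ root) (T.image-inverse zy≈1 (proj₂ root)))
      where
      w v : Carrier
      w = z ^ m
      v = y ^ m
      w+v∈ : Image.InImage E (w + v)
      w+v∈ = Image.image-resp E (chebyshevPower-sum zy≈1 z+y≈ω m) ω^m∈
      difference = reachable-power ordinaryPower-natural E (w - v) 2 z<s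
        (Image.image-resp E
          (trans (sym (square-of-difference (inverse-power zy≈1 m)))
                 (*-congˡ (sym (*-identityʳ (w - v)))))
          (Image.image-+ E (Image.image-* E w+v∈ w+v∈) (Image.image-neg E (Image.image-4 E))))
      S = proj₁ difference
      module S = Image (TowerIn.inside S)
      root = reachable-power ordinaryPower-natural (TowerIn.inside S) z m 0<m
        (S.image-half 2≉0 (S.image-resp (x+y+[x-y]≈x+x w v)
          (S.image-+ (TowerIn.reaches-base S w+v∈) (proj₂ difference))))
      T = proj₁ root
      module T = Image (TowerIn.inside T)

  generatorsSatisfy-⊤ : ∀ {pow} {K L Ω : Field c ℓ} (t : Tower pow K L) (E : Extension L Ω) →
                        GeneratorsSatisfy (λ _ → ⊤) t E
  generatorsSatisfy-⊤ ε       E = tt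
  generatorsSatisfy-⊤ (s ◅ t) E = tt , generatorsSatisfy-⊤ t E

  reciprocalSums-map : ∀ {pow} {K L Ω Ω′ : Field c ℓ} (t : Tower pow K L)
    (E : Extension L Ω) (D : Extension Ω Ω′) →
    GeneratorsSatisfy (FieldIdentities.IsReciprocalSum Ω) t E →
    GeneratorsSatisfy (FieldIdentities.IsReciprocalSum Ω′) t (D ∘ₑ E)
  reciprocalSums-map ε       E D _        = tt
  reciprocalSums-map (s ◅ t) E D (g , gs) = reciprocalSum-map D g , reciprocalSums-map t E D gs

  -- A field over L in which all generators of the tower are of the form z + 1 / z.
  reciprocalSumClosure : ∀ {pow} {K L : Field c ℓ} (t : Tower pow K L) →
    Σ[ Ω ∈ Field c ℓ ] Σ[ E ∈ Extension L Ω ]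
      GeneratorsSatisfy (FieldIdentities.IsReciprocalSum Ω) t E
  reciprocalSumClosure {L = L} ε = L , idExtension L , tt
  reciprocalSumClosure (s ◅ t) with reciprocalSumClosure t
  ... | Ω , E , gs
    with reciprocalSumExtension Ω (Extension.⟦_⟧ E (embed t (RadicalStep.r s)))
  ...   | Ω′ , D , g = Ω′ , D ∘ₑ E , g , reciprocalSums-map t E D gs

  2≉0-extends : {K L : Field c ℓ} → Extension K L →
    ¬ (Field._≈_ K (FieldIdentities.2# K) (Field.0# K)) →
    ¬ (Field._≈_ L (FieldIdentities.2# L) (Field.0# L))
  2≉0-extends {L = L} E 2≉0 2≈0 = 2≉0 (injective
    (trans (+-homo _ _) (trans (+-cong 1#-homo 1#-homo) (trans 2≈0 (sym 0#-homo)))))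
    where
    open ExtensionHomo E
    open Field L

theorem70 : ∀ {c ℓ : Level} → ExcludedMiddle (c ⊔ ℓ) →
    (F : Field c ℓ) → ¬ HasCharacteristic F 2 →
    (P : Polynomial F) →
    SolvableInRadicals F P ⇔ SolvableInChebyshevRadicals F P
theorem70 {c} {ℓ} em F char≠2 P = mk⇔ to from
  where
  open Classical em
  2≉0 : ∀ {K : Field c ℓ} → Extension F K →
        ¬ (Field._≈_ K (FieldIdentities.2# K) (Field.0# K))
  2≉0 E = 2≉0-extends E (λ 2≈0 → char≠2 (2≈0⇒characteristic2 F 2≈0))

  to : SolvableInRadicals F P → SolvableInChebyshevRadicals F P
  to (K , t , P-splits) =
    Transfer.solvable {Ω = K} {pow′ = chebyshev} ordinaryPower-natural (λ _ → ⊤)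
      (λ E ω m _ → radical⇒chebyshev (2≉0 (towerExtension t)) E ω m)
      t (idExtension K) (generatorsSatisfy-⊤ t (idExtension K)) P P-splits

  from : SolvableInChebyshevRadicals F P → SolvableInRadicals F P
  from (K , t , P-splits) =
    let Ω , E , gs = reciprocalSumClosure t in
    Transfer.solvable {pow′ = ordinaryPower} chebyshev-natural
      (FieldIdentities.IsReciprocalSum Ω)
      (chebyshev⇒radical (2≉0 (E ∘ₑ towerExtension t)))
      t E gs P P-splits
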